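{- For $n>0$ and $J\subseteq S$, there is a bijection $\mathrm{NN}_n^J\simeq\mathrm{NC}_n^J$.
   Context: $S=\{s_1,\dots,s_{n-1}\}$ with $s_i=(i,i+1)$ the adjacent transpositions of $\mathfrak{S}_n$. For $J\subseteq S$, writing $J=S\setminus\{s_{j_1},\dots,s_{j_r}\}$ with $j_1<\dots<j_r$, the $J$-regions are $\{1,\dots,j_1\},\{j_1+1,\dots,j_2\},\dots,\{j_r+1,\dots,n\}$. For a set partition $\mathbf P$ of $[n]$, a bump is a pair $(a,b)$, $a<b$, with $a,b$ in the same part and no element of that part strictly between them. $\mathbf P$ is $J$-noncrossing if: (NC1) no two distinct elements of the same $J$-region lie in the same part; (NC2) whenever two distinct bumps $(i_1,i_2),(j_1,j_2)$ satisfy $i_1<j_1<i_2<j_2$, either $i_1,j_1$ lie in the same $J$-region or $i_2,j_1$ lie in the same $J$-region; (NC3) whenever two distinct bumps satisfy $i_1<j_1<j_2<i_2$, then $i_1$ and $j_1$ lie in different $J$-regions. $\mathbf P$ is $J$-nonnesting if (NN1) no two distinct elements of the same $J$-region lie in the same part, and (NN2) there are no two distinct bumps $(i_1,i_2),(j_1,j_2)$ with $i_1<j_1<j_2<i_2$. $\mathrm{NC}_n^J$ and $\mathrm{NN}_n^J$ denote the sets of $J$-noncrossing and $J$-nonnesting partitions of $[n]$. -}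

module Defs where

open import Data.Fin.Base using (Fin; toℕ; _<_)
open import Data.Fin.Subset using (Subset; _∈_; _∉_; Nonempty)
open import Data.Fin.Subset.Properties using (_∈?_)
open import Data.List.Base using (List; _∷_; _∷ʳ_; map; filter; allFin; zip)
open import Data.List.Relation.Unary.Any using (Any)
open import Data.Nat.Base as ℕ using (ℕ; suc; pred)
open import Data.Product.Base using (Σ; ∃-syntax; _×_; _,_; proj₁)
open import Data.Sum.Base using (_⊎_)
open import Function.Base using (id; _∘_)
open import Function.Bundles using (_⇔_; mk⇔; Equivalence)
open import Level using (0ℓ) renaming (suc to lsuc)
open import Relation.Binary.Bundles using (Setoid)
import Relation.Binary.Construct.On as On
open import Relation.Binary.PropositionalEquality using (_≡_; _≢_)
open import Relation.Nullary using (¬_; ¬?)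
open import Relation.Unary using (Pred; Decidable)

-- The set [n] is Fin n, with a : Fin n standing for the number
-- 1 + toℕ a.  A set J of adjacent transpositions of 𝔖ₙ is given by its set of
-- indices: i : Fin (pred n) stands for s_{1 + toℕ i}.

value : ∀ {n} → Fin n → ℕ
value a = suc (toℕ a)

-- The increasing list j₁ < … < jᵣ with J = S \ {s_{j₁}, …, s_{jᵣ}}.
removed : ∀ {m} → Subset m → List ℕ
removed {m} J = map value (filter (λ i → ¬? (i ∈? J)) (allFin m))

-- A pair (l , h) encodes the region {l + 1, …, h}; the list is
-- (0 , j₁), (j₁ , j₂), …, (jᵣ , n).
regions : (n : ℕ) → Subset (pred n) → List (ℕ × ℕ)
regions n J = zip (0 ∷ removed J) (removed J ∷ʳ n)

InRegion : ∀ {n} → Fin n → ℕ × ℕ → Set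
InRegion a (l , h) = l ℕ.< value a × value a ℕ.≤ h

SameRegion : ∀ {n} → Subset (pred n) → Fin n → Fin n → Set
SameRegion {n} J a b = Any (λ R → InRegion a R × InRegion b R) (regions n J)

record SetPartition (n : ℕ) : Set₁ where
  field
    IsPart   : Pred (Subset n) 0ℓ
    isPart?  : Decidable IsPart
    nonempty : ∀ {B} → IsPart B → Nonempty B
    disjoint : ∀ {B C x} → IsPart B → IsPart C → x ∈ B → x ∈ C → B ≡ C
    cover    : ∀ x → ∃[ B ] IsPart B × x ∈ B

open SetPartition public

SetPartitionSetoid : ℕ → Setoid (lsuc 0ℓ) 0ℓ
SetPartitionSetoid n = record
  { Carrier       = SetPartition n
  ; _≈_           = λ P Q → ∀ B → IsPart P B ⇔ IsPart Q B
  ; isEquivalence = record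
    { refl  = λ B → mk⇔ id id
    ; sym   = λ P≈Q B → mk⇔ (from (P≈Q B)) (to (P≈Q B))
    ; trans = λ P≈Q Q≈R B → mk⇔ (to (Q≈R B) ∘ to (P≈Q B)) (from (P≈Q B) ∘ from (Q≈R B))
    }
  }
  where open Equivalence using (to; from)

SamePart : ∀ {n} → SetPartition n → Fin n → Fin n → Set
SamePart P a b = ∃[ B ] IsPart P B × a ∈ B × b ∈ B

Bump : ∀ {n} → SetPartition n → Fin n → Fin n → Set
Bump P a b = a < b × (∃[ B ] IsPart P B × a ∈ B × b ∈ B × (∀ c → a < c → c < b → c ∉ B))

-- In all conditions on two bumps below, i₁ < j₁ already makes them distinct.

RegionsSeparated : ∀ {n} → Subset (pred n) → SetPartition n → Set
RegionsSeparated J P = ∀ a b → a ≢ b → SameRegion J a b → ¬ SamePart P a b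

record IsNoncrossing {n : ℕ} (J : Subset (pred n)) (P : SetPartition n) : Set where
  field
    nc1 : RegionsSeparated J P
    nc2 : ∀ i₁ i₂ j₁ j₂ → Bump P i₁ i₂ → Bump P j₁ j₂ →
          i₁ < j₁ → j₁ < i₂ → i₂ < j₂ →
          SameRegion J i₁ j₁ ⊎ SameRegion J i₂ j₁
    nc3 : ∀ i₁ i₂ j₁ j₂ → Bump P i₁ i₂ → Bump P j₁ j₂ →
          i₁ < j₁ → j₁ < j₂ → j₂ < i₂ →
          ¬ SameRegion J i₁ j₁

record IsNonnesting {n : ℕ} (J : Subset (pred n)) (P : SetPartition n) : Set where
  field
    nn1 : RegionsSeparated J P
    nn2 : ∀ i₁ i₂ j₁ j₂ → Bump P i₁ i₂ → Bump P j₁ j₂ →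
          ¬ (i₁ < j₁ × j₁ < j₂ × j₂ < i₂)

NC : (n : ℕ) → Subset (pred n) → Setoid (lsuc 0ℓ) 0ℓ
NC n J = On.setoid {B = Σ (SetPartition n) (IsNoncrossing J)} (SetPartitionSetoid n) proj₁

NN : (n : ℕ) → Subset (pred n) → Setoid (lsuc 0ℓ) 0ℓ
NN n J = On.setoid {B = Σ (SetPartition n) (IsNonnesting J)} (SetPartitionSetoid n) proj₁

{-# OPTIONS --safe #-}

-- Under (NC1)/(NN1) every bump runs from a region to a strictly later one.
-- Read the closers (right ends of bumps) from left to right; the openers (left
-- ends) that a closer could be joined to are the still unused ones from strictly
-- earlier regions.  A partition is J-nonnesting iff every closer takes the least
-- such opener, and J-noncrossing iff it takes one from the latest possible region
-- and the least one inside that region.  So both are "greedy" for a strict total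
-- order on [n].  For every such order a greedy matching is determined by its sets
-- of openers and closers, and every matching can be made greedy without changing
-- these sets, by exchanging two openers for each closer in turn.  The bijection is
-- the one that preserves the set of openers and the set of closers.
module Submission where

open import Data.Bool.Properties using () renaming (_≟_ to _≟ᵇ_)
open import Data.Fin.Base using (Fin; toℕ; fromℕ<; _<_; _≤_) renaming (_>_ to _>ᶠ_)
open import Data.Fin.Induction using (<-wellFounded; >-wellFounded; spo-wellFounded)
open import Data.Fin.Permutation.Components using (transpose; transpose-inverse)
open import Data.Fin.Properties using (_≟_; _<?_; _≤?_; any?; all?; <-cmp; <-isStrictTotalOrder; toℕ-fromℕ<; toℕ-injective; toℕ<n)
open import Data.Fin.Subset using (Subset; _∈_; _∉_)
open import Data.Fin.Subset.Properties using (_∈?_; ⊆-antisym)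
open import Data.List.Base using ([]; _∷_; _∷ʳ_; zip)
open import Data.List.Relation.Unary.All as All using (_∷_)
open import Data.List.Relation.Unary.AllPairs using (AllPairs; _∷_)
import Data.List.Relation.Unary.All.Properties as All
import Data.List.Relation.Unary.AllPairs.Properties as AllPairs
open import Data.List.Relation.Unary.Any as Any using (Any; here; there)
open import Data.Nat.Base as ℕ using (ℕ; zero; suc; pred; _>_; z≤n; s≤s)
import Data.Nat.Properties as ℕ
open import Data.Product.Base using (∃-syntax; _×_; _,_; proj₁; proj₂; swap)
open import Data.Sum.Base using (_⊎_; inj₁; inj₂)
open import Data.Vec.Base using (tabulate)
open import Data.Vec.Properties using (≡-dec; lookup∘tabulate; lookup⇒[]=; []=⇒lookup)
open import Function.Base using (_∘_)
open import Function.Bundles using (Bijection; Equivalence; mk⇔)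
open import Induction.WellFounded using (Acc; acc)
open import Level using (0ℓ)
open import Relation.Binary.Bundles using (Setoid)
open import Relation.Binary.Core using (Rel)
open import Relation.Binary.Definitions using (Trichotomous; Tri; tri<; tri≈; tri>) renaming (Decidable to Decidable₂)
open import Relation.Binary.PropositionalEquality using (_≡_; _≢_; refl; sym; trans; cong; subst; isEquivalence)
open import Relation.Binary.Structures using (IsStrictTotalOrder)
open import Relation.Nullary using (¬_; ¬?; Dec; yes; no; does; contradiction)
open import Relation.Nullary.Decidable using (map′; dec-true; _×-dec_; _→-dec_)
open import Relation.Unary using (Pred; Decidable; _≐_)
open import Defs

-- Minimal elements and transpositions

minimal : ∀ {n} {_≺_ : Rel (Fin n) 0ℓ} → IsStrictTotalOrder _≡_ _≺_ →
          {Q : Pred (Fin n) 0ℓ} → Decidable Q → ∀ {i} → Q i →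
          ∃[ m ] Q m × (∀ j → Q j → ¬ (j ≺ m))
-- Every strict partial order on `Fin n` is well-founded, so the descent ends for any `≺`.
minimal {_≺_ = _≺_} sto {Q} Q? {i} = search (spo-wellFounded isStrictPartialOrder i)
  where
  open IsStrictTotalOrder sto using (isStrictPartialOrder) renaming (_<?_ to _≺?_)
  search : ∀ {i} → Acc _≺_ i → Q i → ∃[ m ] Q m × (∀ j → Q j → ¬ (j ≺ m))
  search {i} (acc rs) q with any? (λ j → Q? j ×-dec (j ≺? i))
  ... | yes (j , qj , j≺i) = search (rs j≺i) qj
  ... | no  none           = i , q , λ j qj j≺i → none (j , qj , j≺i)

-- The value of `transpose` is an index, so that matching on this view under a `with` also resolves
-- the call.
data Transposed {n : ℕ} (i j k : Fin n) : Fin n → Set where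
  first     : k ≡ i → Transposed i j k j
  second    : k ≡ j → Transposed i j k i
  elsewhere : k ≢ i → k ≢ j → Transposed i j k k

transposed : ∀ {n} (i j k : Fin n) → Transposed i j k (transpose i j k)
transposed i j k with k ≟ i
... | yes k≡i = first k≡i
... | no  k≢i with k ≟ j
...   | yes k≡j = second k≡j
...   | no  k≢j = elsewhere k≢i k≢j

transpose-injective : ∀ {n} (i j : Fin n) {x y} →
                      transpose i j x ≡ transpose i j y → x ≡ y
transpose-injective i j eq =
  trans (sym (transpose-inverse j i)) (trans (cong (transpose j i) eq) (transpose-inverse j i))

-- Regions

Within : ℕ → ℕ × ℕ → Set
Within v (l , h) = l ℕ.< v × v ℕ.≤ h

within⇒above : ∀ {n v w} l xs → AllPairs ℕ._<_ (l ∷ xs) →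
               Any (λ R → Within v R × Within w R) (zip (l ∷ xs) (xs ∷ʳ n)) → l ℕ.< v
within⇒above l []       _                     (here ((l<v , _) , _)) = l<v
within⇒above l (x ∷ xs) _                     (here ((l<v , _) , _)) = l<v
within⇒above l (x ∷ xs) ((l<x ∷ _) ∷ sorted) (there p) =
  ℕ.<-trans l<x (within⇒above x xs sorted p)

-- The regions are disjoint: an element of the first is at most `x`, whereas by `within⇒above` those
-- of later ones exceed `x`. So both hypotheses point to the same entry of the list.
within-trans : ∀ {n u v w} l xs → AllPairs ℕ._<_ (l ∷ xs) →
               Any (λ R → Within u R × Within v R) (zip (l ∷ xs) (xs ∷ʳ n)) →
               Any (λ R → Within v R × Within w R) (zip (l ∷ xs) (xs ∷ʳ n)) →
               Any (λ R → Within u R × Within w R) (zip (l ∷ xs) (xs ∷ʳ n))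
within-trans l []       _ (here (u , _)) (here (_ , w)) = here (u , w)
within-trans l (x ∷ xs) _ (here (u , _)) (here (_ , w)) = here (u , w)
within-trans l (x ∷ xs) (_ ∷ sorted) (here (_ , _ , v≤x)) (there q) =
  contradiction v≤x (ℕ.<⇒≱ (within⇒above x xs sorted q))
within-trans l (x ∷ xs) (_ ∷ sorted) (there p) (here ((_ , v≤x) , _)) =
  contradiction v≤x (ℕ.<⇒≱ (within⇒above x xs sorted (Any.map swap p)))
within-trans l (x ∷ xs) (_ ∷ sorted) (there p) (there q) = there (within-trans x xs sorted p q)

boundaries-sorted : ∀ {m} (J : Subset m) → AllPairs ℕ._<_ (0 ∷ removed J)
boundaries-sorted J =
  All.map⁺ (All.universal (λ _ → s≤s z≤n) _) ∷
  AllPairs.map⁺ (AllPairs.filter⁺ (λ i → ¬? (i ∈? J)) (AllPairs.tabulate⁺-< s≤s))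

module _ {n : ℕ} (J : Subset (pred n)) where

  infix 4 _~_ _⊏_ _≺ᶜ_

  _~_ : Rel (Fin n) 0ℓ
  _~_ = SameRegion J

  ~-sym : ∀ {a b} → a ~ b → b ~ a
  ~-sym = Any.map swap

  ~-trans : ∀ {a b c} → a ~ b → b ~ c → a ~ c
  ~-trans = within-trans 0 (removed J) (boundaries-sorted J)

  ~-convexˡ : ∀ {a b c} → a ≤ b → b ≤ c → a ~ c → a ~ b
  ~-convexˡ a≤b b≤c = Any.map λ where
    (a∈@(l<a , _) , (_ , c≤h)) →
      a∈ , ℕ.≤-trans l<a (s≤s a≤b) , ℕ.≤-trans (s≤s b≤c) c≤h

  ~-convexʳ : ∀ {a b c} → a ≤ b → b ≤ c → a ~ c → b ~ c
  ~-convexʳ a≤b b≤c a~c = ~-trans (~-sym (~-convexˡ a≤b b≤c a~c)) a~c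

  _~?_ : Decidable₂ _~_
  a ~? b = Any.any? (λ (l , h) → ((l ℕ.<? value a) ×-dec (value a ℕ.≤? h)) ×-dec
                                 ((l ℕ.<? value b) ×-dec (value b ℕ.≤? h))) (regions n J)

  -- Regions are consecutive intervals, so this compares regions: that of `a` comes strictly before
  -- that of `b`.
  _⊏_ : Rel (Fin n) 0ℓ
  a ⊏ b = a < b × ¬ (a ~ b)

  _⊏?_ : Decidable₂ _⊏_
  a ⊏? b = (a <? b) ×-dec ¬? (a ~? b)

  ⊏-≤-trans : ∀ {a b c} → a ⊏ b → b ≤ c → a ⊏ c
  ⊏-≤-trans (a<b , a≁b) b≤c = ℕ.<-≤-trans a<b b≤c , a≁b ∘ ~-convexˡ (ℕ.<⇒≤ a<b) b≤c

  <-⊏-trans : ∀ {a b c} → a < b → b ⊏ c → a ⊏ c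
  <-⊏-trans a<b (b<c , b≁c) = ℕ.<-trans a<b b<c , b≁c ∘ ~-convexʳ (ℕ.<⇒≤ a<b) (ℕ.<⇒≤ b<c)

  ~-⊏-trans : ∀ {a b c} → a ~ b → b ⊏ c → a ⊏ c
  ~-⊏-trans {a} {b} {c} a~b (b<c , b≁c) with a <? c
  ... | yes a<c = a<c , b≁c ∘ ~-trans (~-sym a~b)
  -- Here `b < c ≤ a`, and convexity would put `c` in the region of `b`.
  ... | no  a≮c = contradiction (~-convexˡ (ℕ.<⇒≤ b<c) (ℕ.≮⇒≥ a≮c) (~-sym a~b)) b≁c

  ⊏-~-trans : ∀ {a b c} → a ⊏ b → b ~ c → a ⊏ c
  ⊏-~-trans {a} {b} {c} (a<b , a≁b) b~c with a <? c
  ... | yes a<c = a<c , λ a~c → a≁b (~-trans a~c (~-sym b~c))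
  ... | no  a≮c = contradiction (~-convexʳ (ℕ.≮⇒≥ a≮c) (ℕ.<⇒≤ a<b) (~-sym b~c)) a≁b

  -- Later regions come first, but each region keeps its own order. The minimum of the available
  -- openers is thus the choice of a noncrossing partition.
  _≺ᶜ_ : Rel (Fin n) 0ℓ
  a ≺ᶜ b = b ⊏ a ⊎ (a ~ b × a < b)

  ≺ᶜ-trans : ∀ {a b c} → a ≺ᶜ b → b ≺ᶜ c → a ≺ᶜ c
  ≺ᶜ-trans (inj₁ b⊏a)         (inj₁ c⊏b)         = inj₁ (⊏-≤-trans c⊏b (ℕ.<⇒≤ (proj₁ b⊏a)))
  ≺ᶜ-trans (inj₁ b⊏a)         (inj₂ (b~c , _))   = inj₁ (~-⊏-trans (~-sym b~c) b⊏a)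
  ≺ᶜ-trans (inj₂ (a~b , _))   (inj₁ c⊏b)         = inj₁ (⊏-~-trans c⊏b (~-sym a~b))
  ≺ᶜ-trans (inj₂ (a~b , a<b)) (inj₂ (b~c , b<c)) = inj₂ (~-trans a~b b~c , ℕ.<-trans a<b b<c)

  ≺ᶜ-irrefl : ∀ {a b} → a ≡ b → ¬ (a ≺ᶜ b)
  ≺ᶜ-irrefl refl (inj₁ (a<a , _)) = ℕ.<-irrefl refl a<a
  ≺ᶜ-irrefl refl (inj₂ (_ , a<a)) = ℕ.<-irrefl refl a<a

  ≺ᶜ-cmp : Trichotomous _≡_ _≺ᶜ_
  ≺ᶜ-cmp a b = classify (total a b)
    where
    total : ∀ a b → a ≺ᶜ b ⊎ a ≡ b ⊎ b ≺ᶜ a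
    total a b with <-cmp a b | a ~? b
    ... | tri< a<b _ _ | yes a~b = inj₁ (inj₂ (a~b , a<b))
    ... | tri< a<b _ _ | no  a≁b = inj₂ (inj₂ (inj₁ (a<b , a≁b)))
    ... | tri≈ _ a≡b _ | _       = inj₂ (inj₁ a≡b)
    ... | tri> _ _ b<a | yes a~b = inj₂ (inj₂ (inj₂ (~-sym a~b , b<a)))
    ... | tri> _ _ b<a | no  a≁b = inj₁ (inj₁ (b<a , a≁b ∘ ~-sym))
    classify : a ≺ᶜ b ⊎ a ≡ b ⊎ b ≺ᶜ a → _
    classify (inj₁ a≺b)        = tri< a≺b (λ a≡b → ≺ᶜ-irrefl a≡b a≺b) (≺ᶜ-irrefl refl ∘ ≺ᶜ-trans a≺b)
    classify (inj₂ (inj₁ a≡b)) = tri≈ (≺ᶜ-irrefl a≡b) a≡b (≺ᶜ-irrefl (sym a≡b))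
    classify (inj₂ (inj₂ b≺a)) = tri> (≺ᶜ-irrefl refl ∘ ≺ᶜ-trans b≺a) (λ a≡b → ≺ᶜ-irrefl (sym a≡b) b≺a) b≺a

  ≺ᶜ-isStrictTotalOrder : IsStrictTotalOrder _≡_ _≺ᶜ_
  ≺ᶜ-isStrictTotalOrder = record
    { isStrictPartialOrder = record
      { isEquivalence = isEquivalence
      ; irrefl        = ≺ᶜ-irrefl
      ; trans         = ≺ᶜ-trans
      ; <-resp-≈      = (λ { refl p → p }) , (λ { refl p → p })
      }
    ; compare = ≺ᶜ-cmp
    }

-- Bumps of a set partition

module _ {n : ℕ} (P : SetPartition n) where

  block : Fin n → Subset n
  block a = proj₁ (cover P a)

  block-isPart : ∀ a → IsPart P (block a)
  block-isPart a = proj₁ (proj₂ (cover P a))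

  ∈-block : ∀ a → a ∈ block a
  ∈-block a = proj₂ (proj₂ (cover P a))

  samePart-sym : ∀ {a b} → SamePart P a b → SamePart P b a
  samePart-sym (B , isP , a∈B , b∈B) = B , isP , b∈B , a∈B

  samePart-trans : ∀ {a b c} → SamePart P a b → SamePart P b c → SamePart P a c
  samePart-trans (B , isP , a∈B , b∈B) (C , isP′ , b∈C , c∈C)
    with refl ← disjoint P isP isP′ b∈B b∈C = B , isP , a∈B , c∈C

  bump⇒samePart : ∀ {a b} → Bump P a b → SamePart P a b
  bump⇒samePart (_ , B , isP , a∈B , b∈B , _) = B , isP , a∈B , b∈B

  -- By disjointness the part of a bump from `a` can only be `block a`, which removes the quantifier
  -- over parts.
  bump? : Decidable₂ (Bump P)
  bump? a b = map′ to from ((a <? b) ×-dec ((b ∈? block a) ×-dec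
                all? (λ c → (a <? c) →-dec ((c <? b) →-dec ¬? (c ∈? block a)))))
    where
    to : _ → Bump P a b
    to (a<b , b∈ , gap) = a<b , block a , block-isPart a , ∈-block a , b∈ , gap
    from : Bump P a b → _
    from (a<b , B , isP , a∈B , b∈B , gap)
      with refl ← disjoint P isP (block-isPart a) a∈B (∈-block a) = a<b , b∈B , gap

  bump-functional : ∀ {a b c} → Bump P a b → Bump P a c → b ≡ c
  bump-functional {a} {b} {c} (a<b , B , isP , a∈B , b∈B , gap) (a<c , C , isP′ , a∈C , c∈C , gap′)
    with refl ← disjoint P isP isP′ a∈B a∈C | <-cmp b c
  ... | tri< b<c _ _ = contradiction b∈B (gap′ b a<b b<c)
  ... | tri≈ _ b≡c _ = b≡c
  ... | tri> _ _ c<b = contradiction c∈C (gap c a<c c<b)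

  bump-injective : ∀ {a b c} → Bump P a c → Bump P b c → a ≡ b
  bump-injective {a} {b} {c} (a<c , B , isP , a∈B , c∈B , gap) (b<c , C , isP′ , b∈C , c∈C , gap′)
    with refl ← disjoint P isP isP′ c∈B c∈C | <-cmp a b
  ... | tri< a<b _ _ = contradiction b∈C (gap b a<b b<c)
  ... | tri≈ _ a≡b _ = a≡b
  ... | tri> _ _ b<a = contradiction a∈B (gap′ a b<a a<c)

  -- The bump goes to the next element of the part after `a`; `b` is a candidate for it.
  samePart⇒bump : ∀ {a b} → SamePart P a b → a < b → ∃[ c ] Bump P a c × c ≤ b
  samePart⇒bump {a} {b} (B , isP , a∈B , b∈B) a<b
    with c , (a<c , c∈B) , least ← minimal <-isStrictTotalOrder (λ c → (a <? c) ×-dec (c ∈? B)) (a<b , b∈B)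
    = c , (a<c , B , isP , a∈B , c∈B , λ d a<d d<c d∈B → least d (a<d , d∈B) d<c)
        , ℕ.≮⇒≥ (least b (a<b , b∈B))

-- Two elements of a part are joined by a chain of bumps, and each link survives in `Q`. The
-- recursion raises the lower endpoint.
bumps⊆⇒samePart⊆ : ∀ {n} (P Q : SetPartition n) → (∀ {a b} → Bump P a b → Bump Q a b) →
                   ∀ {a b} → SamePart P a b → SamePart Q a b
bumps⊆⇒samePart⊆ P Q bumps⊆ {a} {b} same = compare (<-cmp a b)
  where
  ascend : ∀ {a b} → Acc _>ᶠ_ a → SamePart P a b → a < b → SamePart Q a b
  ascend {a} {b} (acc rs) same a<b with samePart⇒bump P same a<b
  ... | c , bump , c≤b with <-cmp c b
  ...   | tri≈ _ refl _ = bump⇒samePart Q (bumps⊆ bump)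
  ...   | tri> _ _ b<c  = contradiction c≤b (ℕ.<⇒≱ b<c)
  ...   | tri< c<b _ _  = samePart-trans Q (bump⇒samePart Q (bumps⊆ bump))
    (ascend (rs (proj₁ bump)) (samePart-trans P (samePart-sym P (bump⇒samePart P bump)) same) c<b)
  compare : Tri (a < b) (a ≡ b) (b < a) → SamePart Q a b
  compare (tri< a<b _ _)  = ascend (>-wellFounded a) same a<b
  compare (tri≈ _ refl _) = block Q a , block-isPart Q a , ∈-block Q a , ∈-block Q a
  compare (tri> _ _ b<a)  = samePart-sym Q (ascend (>-wellFounded b) (samePart-sym P same) b<a)

-- A part is recovered from any of its elements: for `x` in `B`, the block of `x` in `Q` has the
-- same elements as `B`, hence equals it.
samePart≐⇒part⊆ : ∀ {n} (P Q : SetPartition n) →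
                  (∀ {a b} → SamePart P a b → SamePart Q a b) →
                  (∀ {a b} → SamePart Q a b → SamePart P a b) →
                  ∀ {B} → IsPart P B → IsPart Q B
samePart≐⇒part⊆ P Q P⊆Q Q⊆P {B} isP with nonempty P isP
... | x , x∈B = subst (IsPart Q) (⊆-antisym ⊆B B⊆) (block-isPart Q x)
  where
  ⊆B : ∀ {y} → y ∈ block Q x → y ∈ B
  ⊆B y∈ with C , isP′ , x∈C , y∈C ← Q⊆P (_ , block-isPart Q x , ∈-block Q x , y∈)
        with refl ← disjoint P isP isP′ x∈B x∈C = y∈C
  B⊆ : ∀ {y} → y ∈ B → y ∈ block Q x
  B⊆ y∈ with C , isQ , x∈C , y∈C ← P⊆Q (_ , isP , x∈B , y∈)
        with refl ← disjoint Q isQ (block-isPart Q x) x∈C (∈-block Q x) = y∈C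

bumps≐⇒≈ : ∀ {n} (P Q : SetPartition n) →
           (∀ {a b} → Bump P a b → Bump Q a b) → (∀ {a b} → Bump Q a b → Bump P a b) →
           Setoid._≈_ (SetPartitionSetoid n) P Q
bumps≐⇒≈ P Q P⊆Q Q⊆P B = mk⇔ (samePart≐⇒part⊆ P Q P⊆Q′ Q⊆P′) (samePart≐⇒part⊆ Q P Q⊆P′ P⊆Q′)
  where
  P⊆Q′ : ∀ {a b} → SamePart P a b → SamePart Q a b
  P⊆Q′ = bumps⊆⇒samePart⊆ P Q P⊆Q
  Q⊆P′ : ∀ {a b} → SamePart Q a b → SamePart P a b
  Q⊆P′ = bumps⊆⇒samePart⊆ Q P Q⊆P

≈⇒bumps⊆ : ∀ {n} (P Q : SetPartition n) → Setoid._≈_ (SetPartitionSetoid n) P Q →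
           ∀ {a b} → Bump P a b → Bump Q a b
≈⇒bumps⊆ P Q P≈Q (a<b , B , isP , rest) = a<b , B , Equivalence.to (P≈Q B) isP , rest

-- Sets of openers and closers

Opener Closer : ∀ {n} → Rel (Fin n) 0ℓ → Pred (Fin n) 0ℓ
Opener R x = ∃[ y ] R x y
Closer R y = ∃[ x ] R x y

infix 4 _≑_

-- A record, so that the two relations can be inferred.
record _≑_ {n : ℕ} (R S : Rel (Fin n) 0ℓ) : Set where
  field
    openers : Opener R ≐ Opener S
    closers : Closer R ≐ Closer S

≑-sym : ∀ {n} {R S : Rel (Fin n) 0ℓ} → R ≑ S → S ≑ R
≑-sym r = record { openers = swap openers ; closers = swap closers }
  where open _≑_ r

≑-trans : ∀ {n} {R S T : Rel (Fin n) 0ℓ} → R ≑ S → S ≑ T → R ≑ T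
≑-trans r s = record
  { openers = (λ x → proj₁ S.openers (proj₁ R.openers x)) , (λ x → proj₂ R.openers (proj₂ S.openers x))
  ; closers = (λ x → proj₁ S.closers (proj₁ R.closers x)) , (λ x → proj₂ R.closers (proj₂ S.closers x))
  }
  where
  module R = _≑_ r
  module S = _≑_ s

⇔⇒≑ : ∀ {n} {R S : Rel (Fin n) 0ℓ} →
      (∀ {a b} → R a b → S a b) → (∀ {a b} → S a b → R a b) → R ≑ S
⇔⇒≑ R⊆S S⊆R = record
  { openers = (λ (y , r) → y , R⊆S r) , (λ (y , s) → y , S⊆R s)
  ; closers = (λ (x , r) → x , R⊆S r) , (λ (x , s) → x , S⊆R s)
  }

≈⇒≑ : ∀ {n} (P Q : SetPartition n) → Setoid._≈_ (SetPartitionSetoid n) P Q → Bump P ≑ Bump Q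
≈⇒≑ {n} P Q P≈Q =
  ⇔⇒≑ (≈⇒bumps⊆ P Q P≈Q) (≈⇒bumps⊆ Q P (Setoid.sym (SetPartitionSetoid n) {P} {Q} P≈Q))

-- The set partition with prescribed bumps

module _ {n : ℕ} {R : Rel (Fin n) 0ℓ} (R? : Decidable₂ R)
         (functional : ∀ {x y z} → R x y → R x z → y ≡ z)
         (injective : ∀ {x y z} → R x z → R y z → x ≡ y)
         (increasing : ∀ {x y} → R x y → x < y) where

  private
    closer? : Decidable (Closer R)
    closer? y = any? (λ x → R? x y)

    -- The arcs form disjoint increasing paths. This walks back to the start of a path, and the
    -- parts will be the fibres of `root`.
    rootAcc : ∀ y → Acc _<_ y → Fin n
    rootAcc y (acc rs) with closer? y
    ... | yes (x , r) = rootAcc x (rs (increasing r))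
    ... | no  _       = y

    rootAcc-irrelevant : ∀ {y} (p q : Acc _<_ y) → rootAcc y p ≡ rootAcc y q
    rootAcc-irrelevant {y} (acc p) (acc q) with closer? y
    ... | yes (x , r) = rootAcc-irrelevant (p (increasing r)) (q (increasing r))
    ... | no  _       = refl

    rootAcc-≤ : ∀ {y} (p : Acc _<_ y) → rootAcc y p ≤ y
    rootAcc-≤ {y} (acc p) with closer? y
    ... | yes (x , r) = ℕ.≤-trans (rootAcc-≤ (p (increasing r))) (ℕ.<⇒≤ (increasing r))
    ... | no  _       = ℕ.≤-refl

    rootAcc-arc : ∀ {x y} (p : Acc _<_ x) (q : Acc _<_ y) → R x y → rootAcc x p ≡ rootAcc y q
    rootAcc-arc {x} {y} p (acc q) r with closer? y
    ... | no ¬c = contradiction (x , r) ¬c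
    ... | yes (x′ , r′) with refl ← injective r r′ = rootAcc-irrelevant p (q (increasing r′))

    rootAcc-start : ∀ {y} (p : Acc _<_ y) → ¬ Closer R y → rootAcc y p ≡ y
    rootAcc-start {y} (acc p) ¬c with closer? y
    ... | yes c = contradiction c ¬c
    ... | no  _ = refl

    root : Fin n → Fin n
    root y = rootAcc y (<-wellFounded y)

    arc⇒root≡ : ∀ {x y} → R x y → root x ≡ root y
    arc⇒root≡ = rootAcc-arc (<-wellFounded _) (<-wellFounded _)

    -- Walking back from `y` along its path must reach `x`; the arc leaving `x` is the last one
    -- traversed.
    root≡⇒arc : ∀ {x y} → Acc _<_ y → root x ≡ root y → x < y → ∃[ z ] R x z × z ≤ y
    root≡⇒arc {x} {y} (acc rs) eq x<y = step (closer? y)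
      where
      step : Dec (Closer R y) → ∃[ z ] R x z × z ≤ y
      -- A `y` without incoming arc is its own root, and a root never exceeds its element, so
      -- `y ≤ x` would follow.
      step (no ¬c) = contradiction
        (subst (_≤ x) (trans eq (rootAcc-start (<-wellFounded y) ¬c)) (rootAcc-≤ (<-wellFounded x)))
        (ℕ.<⇒≱ x<y)
      step (yes (w , r)) with <-cmp x w
      ... | tri≈ _ refl _ = y , r , ℕ.≤-refl
      ... | tri< x<w _ _
        with z , s , z≤w ← root≡⇒arc (rs (increasing r)) (trans eq (sym (arc⇒root≡ r))) x<w
        = z , s , ℕ.≤-trans z≤w (ℕ.<⇒≤ (increasing r))
      -- The walk cannot jump over `x`: applied to `w < x`, the lemma gives an arc from `w` ending
      -- at or before `x`, but that arc ends at `y`.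
      ... | tri> _ _ w<x
        with z , s , z≤x ← root≡⇒arc (rs x<y) (trans (arc⇒root≡ r) (sym eq)) w<x
        with refl ← functional r s = contradiction z≤x (ℕ.<⇒≱ x<y)

    class : Fin n → Subset n
    class x = tabulate (λ y → does (root y ≟ root x))

    ∈-class⁺ : ∀ {x y} → root y ≡ root x → y ∈ class x
    ∈-class⁺ {x} {y} eq = lookup⇒[]= y _
      (trans (lookup∘tabulate _ y) (dec-true (root y ≟ root x) eq))

    ∈-class⁻ : ∀ {x y} → y ∈ class x → root y ≡ root x
    ∈-class⁻ {x} {y} y∈
      with root y ≟ root x | trans (sym (lookup∘tabulate (λ y → does (root y ≟ root x)) y)) ([]=⇒lookup y∈)
    ... | yes eq | _ = eq
    ... | no  _  | ()

  fromArcs : SetPartition n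
  fromArcs = record
    { IsPart   = λ B → ∃[ x ] B ≡ class x
    ; isPart?  = λ B → any? (λ x → ≡-dec _≟ᵇ_ B (class x))
    ; nonempty = λ { (x , refl) → x , ∈-class⁺ refl }
    ; disjoint = λ { (x , refl) (y , refl) z∈x z∈y →
        let eq = trans (sym (∈-class⁻ z∈x)) (∈-class⁻ z∈y) in
        ⊆-antisym (λ w∈x → ∈-class⁺ (trans (∈-class⁻ w∈x) eq))
                  (λ w∈y → ∈-class⁺ (trans (∈-class⁻ w∈y) (sym eq))) }
    ; cover    = λ x → class x , (x , refl) , ∈-class⁺ refl
    }

  arc⇒bump : ∀ {a b} → R a b → Bump fromArcs a b
  arc⇒bump {a} {b} r = increasing r , class a , (a , refl) , ∈-class⁺ refl ,
                       ∈-class⁺ (sym (arc⇒root≡ r)) , gap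
    where
    gap : ∀ c → a < c → c < b → c ∉ class a
    -- An element of the class after `a` is at or beyond the end of the arc from `a`, which is `b`.
    gap c a<c c<b c∈ with z , s , z≤c ← root≡⇒arc (<-wellFounded c) (sym (∈-class⁻ c∈)) a<c
                     with refl ← functional r s = contradiction z≤c (ℕ.<⇒≱ c<b)

  bump⇒arc : ∀ {a b} → Bump fromArcs a b → R a b
  bump⇒arc {a} {b} (a<b , B , (x , refl) , a∈ , b∈ , gap)
    with root≡⇒arc (<-wellFounded b) (trans (∈-class⁻ a∈) (sym (∈-class⁻ b∈))) a<b
  ... | z , r , z≤b with z ≟ b
  ...   | yes refl = r
  ...   | no  z≢b  = contradiction
    (∈-class⁺ (trans (sym (arc⇒root≡ r)) (∈-class⁻ a∈)))
    (gap z (increasing r) (ℕ.≤∧≢⇒< z≤b (z≢b ∘ toℕ-injective)))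

-- Greedy matchings

module _ {n : ℕ} (J : Subset (pred n)) where

  private
    infix 4 _⊏ᴶ_
    _⊏ᴶ_ : Rel (Fin n) 0ℓ
    _⊏ᴶ_ = _⊏_ J

  -- Exchanges are carried out on bare arcs; parts are rebuilt only once, by `fromArcs`.
  record Matching : Set₁ where
    field
      Arc        : Rel (Fin n) 0ℓ
      arc?       : Decidable₂ Arc
      functional : ∀ {x y z} → Arc x y → Arc x z → y ≡ z
      injective  : ∀ {x y z} → Arc x z → Arc y z → x ≡ y
      advancing  : ∀ {x y} → Arc x y → x ⊏ᴶ y

  open Matching

  GreedyAt : Rel (Fin n) 0ℓ → Rel (Fin n) 0ℓ → Fin n → Set
  GreedyAt _≺_ R y = ∀ {x z w} → R x y → R z w → y < w → z ⊏ᴶ y → ¬ (z ≺ x)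

  Greedy : Rel (Fin n) 0ℓ → Rel (Fin n) 0ℓ → Set
  Greedy _≺_ R = ∀ y → GreedyAt _≺_ R y

  -- The closer c exchanges its opener i with another available opener j.
  module Exchange (M : Matching) {c i j j′ : Fin n} (i→c : Arc M i c) (j→j′ : Arc M j j′)
                  (j⊏c : j ⊏ᴶ c) (c≤j′ : c ≤ j′) where

    exchange : Matching
    exchange = record
      -- Precomposition swaps the right ends: the new arcs are `j` to `c` and `i` to `j′`. If `i`
      -- equals `j`, nothing changes.
      { Arc        = λ x → Arc M (transpose i j x)
      ; arc?       = λ x → arc? M (transpose i j x)
      ; functional = functional M
      ; injective  = λ r s → transpose-injective i j (injective M r s)
      ; advancing  = advancing′
      }
      where
      advancing′ : ∀ {x y} → Arc M (transpose i j x) y → x ⊏ᴶ y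
      advancing′ {x} r with transpose i j x | transposed i j x
      ... | _ | first refl with refl ← functional M r j→j′ = ⊏-≤-trans J (advancing M i→c) c≤j′
      ... | _ | second refl with refl ← functional M r i→c = j⊏c
      ... | _ | elsewhere _ _ = advancing M r

    exchange-≑ : Arc M ≑ Arc exchange
    exchange-≑ = record
      { openers = o , o′
      ; closers = (λ {y} (x , r) → transpose j i x , subst (λ x → Arc M x y) (sym (transpose-inverse i j)) r)
                , (λ (x , r) → transpose i j x , r)
      }
      where
      o : ∀ {x} → Opener (Arc M) x → Opener (Arc exchange) x
      o {x} r with transpose i j x | transposed i j x
      ... | _ | first refl    = j′ , j→j′
      ... | _ | second refl   = c , i→c
      ... | _ | elsewhere _ _ = r
      o′ : ∀ {x} → Opener (Arc exchange) x → Opener (Arc M) x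
      o′ {x} r with transpose i j x | transposed i j x
      ... | _ | first refl    = c , i→c
      ... | _ | second refl   = j′ , j→j′
      ... | _ | elsewhere _ _ = r

    -- Both exchanged arcs end at `c` or later, before and after the exchange.
    arc-before : ∀ {x y} → y < c → Arc exchange x y → Arc M x y
    arc-before {x} y<c r with transpose i j x | transposed i j x
    ... | _ | first refl with refl ← functional M r j→j′ = contradiction c≤j′ (ℕ.<⇒≱ y<c)
    ... | _ | second refl with refl ← functional M r i→c = contradiction y<c (ℕ.<-irrefl refl)
    ... | _ | elsewhere _ _ = r

    arc-at : ∀ {x} → Arc exchange x c → x ≡ j
    arc-at {x} r with transpose i j x | transposed i j x
    ... | _ | first refl      = injective M i→c r
    ... | _ | second x≡j      = x≡j
    ... | _ | elsewhere x≢i _ = contradiction (injective M r i→c) x≢i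

    -- This shows that an opener available to a closer up to `c` after the exchange was available
    -- before it.
    arc-from : ∀ {x y} → Arc exchange x y → ∃[ w ] Arc M x w × (c ≤ w ⊎ w ≡ y)
    arc-from {x} {y} r with transpose i j x | transposed i j x
    ... | _ | first refl    = c , i→c , inj₁ ℕ.≤-refl
    ... | _ | second refl   = j′ , j→j′ , inj₁ c≤j′
    ... | _ | elsewhere _ _ = y , r , inj₂ refl

  module _ {_≺_ : Rel (Fin n) 0ℓ} (sto : IsStrictTotalOrder _≡_ _≺_) where

    -- If y is the first closer at which M and N differ, then the openers which M and
    -- N give to it are available to y in both matchings.
    greedy-unique : (M N : Matching) → Greedy _≺_ (Arc M) → Greedy _≺_ (Arc N) →
                    Arc M ≑ Arc N → ∀ {x y} → Acc _<_ y → Arc M x y → Arc N x y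
    greedy-unique M N gM gN M≑N {x} {y} (acc rs) m with proj₁ (_≑_.closers M≑N) (x , m)
    ... | z , r with proj₁ (_≑_.openers M≑N) (y , m) | proj₂ (_≑_.openers M≑N) (y , r)
    ... | w , x→w | v , z→v with <-cmp w y | <-cmp v y
    ... | tri≈ _ refl _ | _ = x→w
    -- By induction with the roles of `M` and `N` interchanged, `M` also joins `x` to `w`, although
    -- it joins `x` to `y`.
    ... | tri< w<y _ _  | _ = contradiction
      (functional M m (greedy-unique N M gN gM (≑-sym M≑N) (rs w<y) x→w))
      (λ { refl → ℕ.<-irrefl refl w<y })
    ... | tri> _ _ _    | tri≈ _ refl _ = subst (λ z → Arc N z y) (injective M z→v m) r
    ... | tri> _ _ _    | tri< v<y _ _ = contradiction
      (functional N r (greedy-unique M N gM gN M≑N (rs v<y) z→v))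
      (λ { refl → ℕ.<-irrefl refl v<y })
    -- Whichever of `x` and `z` is preferred, the matching that gives the other one to `y` is not
    -- greedy.
    ... | tri> _ _ y<w  | tri> _ _ y<v with IsStrictTotalOrder.compare sto x z
    ...   | tri< x≺z _ _  = contradiction x≺z (gN y r x→w y<w (advancing M m))
    ...   | tri≈ _ refl _ = r
    ...   | tri> _ _ z≺x  = contradiction z≺x (gM y m z→v y<v (advancing N r))

    -- The bound is a natural number because the induction has to end at `n`.
    GreedyBelow : ℕ → Matching → Set
    GreedyBelow t M = ∀ y → toℕ y ℕ.< t → GreedyAt _≺_ (Arc M) y

    -- Giving `c` the least available opener makes it greedy and keeps all earlier closers greedy.
    greedy-step : (M : Matching) (c : Fin n) → GreedyBelow (toℕ c) M →
                  ∃[ N ] Arc M ≑ Arc N × GreedyBelow (suc (toℕ c)) N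
    greedy-step M c below with any? (λ i → arc? M i c)
    ... | no ¬closer = M , ⇔⇒≑ (λ r → r) (λ r → r) , below′
      where
      below′ : GreedyBelow (suc (toℕ c)) M
      below′ y (s≤s y≤c) with y ≟ c
      ... | yes refl = λ r → contradiction (_ , r) ¬closer
      ... | no  y≢c  = below y (ℕ.≤∧≢⇒< y≤c (y≢c ∘ toℕ-injective))
    ... | yes (i , i→c)
      -- The inequality `c ≤ w` is not strict, so the present opener `i` is itself a candidate.
      with minimal sto (λ z → _⊏?_ J z c ×-dec any? (λ w → arc? M z w ×-dec (c ≤? w)))
                   (advancing M i→c , c , i→c , ℕ.≤-refl)
    ... | j , (j⊏c , j′ , j→j′ , c≤j′) , least = exchange , exchange-≑ , below′
      where
      open Exchange M i→c j→j′ j⊏c c≤j′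
      below′ : GreedyBelow (suc (toℕ c)) exchange
      below′ y (s≤s y≤c) {x} {z} {w} r s y<w z⊏y with y ≟ c | arc-from {z} {w} s
      -- The opener of `c` is now `j`, and a competitor `z` was already among the candidates over
      -- which `j` is least.
      ... | yes refl | w′ , s′ , far with refl ← arc-at {x} r = least _ (z⊏y , w′ , s′ , c≤w′ far)
        where
        c≤w′ : c ≤ w′ ⊎ w′ ≡ w → c ≤ w′
        c≤w′ (inj₁ c≤w′) = c≤w′
        c≤w′ (inj₂ refl) = ℕ.<⇒≤ y<w
      ... | no y≢c | w′ , s′ , far = below y y<c (arc-before {x} y<c r) s′ (y<w′ far) z⊏y
        where
        y<c : y < c
        y<c = ℕ.≤∧≢⇒< y≤c (y≢c ∘ toℕ-injective)
        y<w′ : c ≤ w′ ⊎ w′ ≡ w → y < w′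
        y<w′ (inj₁ c≤w′) = ℕ.<-≤-trans y<c c≤w′
        y<w′ (inj₂ refl) = y<w

    greedy-upTo : (M : Matching) → ∀ t → t ℕ.≤ n → ∃[ N ] Arc M ≑ Arc N × GreedyBelow t N
    greedy-upTo M zero    _   = M , ⇔⇒≑ (λ r → r) (λ r → r) , λ _ ()
    greedy-upTo M (suc t) t<n
      with N , M≑N , below ← greedy-upTo M t (ℕ.<⇒≤ t<n)
      with N′ , N≑N′ , below′ ← greedy-step N (fromℕ< t<n)
                                  (subst (λ t → GreedyBelow t N) (sym (toℕ-fromℕ< t<n)) below)
      = N′ , ≑-trans M≑N N≑N′ , subst (λ t → GreedyBelow (suc t) N′) (toℕ-fromℕ< t<n) below′

  -- Greedy set partitions

  GreedyPartition : Rel (Fin n) 0ℓ → SetPartition n → Set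
  GreedyPartition _≺_ P = RegionsSeparated J P × Greedy _≺_ (Bump P)

  bumpMatching : (P : SetPartition n) → RegionsSeparated J P → Matching
  bumpMatching P separated = record
    { Arc        = Bump P
    ; arc?       = bump? P
    ; functional = bump-functional P
    ; injective  = bump-injective P
    ; advancing  = λ b → proj₁ b , λ same →
        separated _ _ (λ { refl → ℕ.<-irrefl refl (proj₁ b) }) same (bump⇒samePart P b)
    }

  -- If two elements of a region shared a part, the bump leaving the smaller would end at or before
  -- the larger and, by convexity, stay inside the region.
  advancing⇒separated : (P : SetPartition n) → (∀ {a b} → Bump P a b → a ⊏ᴶ b) → RegionsSeparated J P
  advancing⇒separated P adv a b a≢b a~b same with <-cmp a b
  ... | tri< a<b _ _ with c , bump , c≤b ← samePart⇒bump P same a<b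
    = proj₂ (adv bump) (~-convexˡ J (ℕ.<⇒≤ (proj₁ bump)) c≤b a~b)
  ... | tri≈ _ a≡b _ = a≢b a≡b
  ... | tri> _ _ b<a with c , bump , c≤a ← samePart⇒bump P (samePart-sym P same) b<a
    = proj₂ (adv bump) (~-convexˡ J (ℕ.<⇒≤ (proj₁ bump)) c≤a (~-sym J a~b))

  module _ {_≺_ : Rel (Fin n) 0ℓ} (sto : IsStrictTotalOrder _≡_ _≺_) where

    greedyPartition-unique : ∀ P Q → GreedyPartition _≺_ P → GreedyPartition _≺_ Q →
                             Bump P ≑ Bump Q → Setoid._≈_ (SetPartitionSetoid n) P Q
    greedyPartition-unique P Q (sepP , gP) (sepQ , gQ) P≑Q = bumps≐⇒≈ P Q
      (greedy-unique sto M N gP gQ P≑Q (<-wellFounded _))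
      (greedy-unique sto N M gQ gP (≑-sym P≑Q) (<-wellFounded _))
      where
      M N : Matching
      M = bumpMatching P sepP
      N = bumpMatching Q sepQ

    greedyPartition-exists : ∀ P → RegionsSeparated J P →
                             ∃[ Q ] GreedyPartition _≺_ Q × Bump P ≑ Bump Q
    greedyPartition-exists P sep with greedy-upTo sto (bumpMatching P sep) n ℕ.≤-refl
    ... | N , P≑N , below =
      Q , (advancing⇒separated Q (λ b → advancing N (to b)) ,
           λ y r s → below y (toℕ<n y) (to r) (to s)) ,
      ≑-trans P≑N (⇔⇒≑ from to)
      where
      increasing : ∀ {a b} → Arc N a b → a < b
      increasing r = proj₁ (advancing N r)
      Q : SetPartition n
      Q = fromArcs (arc? N) (functional N) (injective N) increasing
      to : ∀ {a b} → Bump Q a b → Arc N a b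
      to = bump⇒arc (arc? N) (functional N) (injective N) increasing
      from : ∀ {a b} → Arc N a b → Bump Q a b
      from = arc⇒bump (arc? N) (functional N) (injective N) increasing

  -- Nonnesting and noncrossing as greediness

  nonnesting⇒greedy : ∀ {P} → IsNonnesting J P → GreedyPartition _<_ P
  nonnesting⇒greedy nn = nn1 , λ y r s y<w _ z<x → nn2 _ _ _ _ s r (z<x , proj₁ r , y<w)
    where open IsNonnesting nn

  -- In a nesting, the outer opener is available to the inner closer and is smaller than the opener
  -- taken.
  greedy⇒nonnesting : ∀ {P} → GreedyPartition _<_ P → IsNonnesting J P
  greedy⇒nonnesting {P} (sep , greedy) = record
    { nn1 = sep
    ; nn2 = λ i₁ i₂ j₁ j₂ bi bj (i₁<j₁ , j₁<j₂ , j₂<i₂) →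
        greedy j₂ bj bi j₂<i₂ (<-⊏-trans J i₁<j₁ (advancing (bumpMatching P sep) bj)) i₁<j₁
    }

  -- The clauses of `≺ᶜ` match the conditions: a preferred opener in a later region gives a crossing
  -- against (NC2), one in the same region a nesting against (NC3).
  noncrossing⇒greedy : ∀ {P} → IsNoncrossing J P → GreedyPartition (_≺ᶜ_ J) P
  noncrossing⇒greedy {P} nc = nc1 , greedy
    where
    open IsNoncrossing nc
    greedy : Greedy (_≺ᶜ_ J) (Bump P)
    greedy y r s y<w (z<y , z≁y) (inj₁ (x<z , x≁z)) with nc2 _ _ _ _ r s x<z z<y y<w
    ... | inj₁ x~z = x≁z x~z
    ... | inj₂ y~z = z≁y (~-sym J y~z)
    greedy y r s y<w _ (inj₂ (z~x , z<x)) = nc3 _ _ _ _ s r z<x (proj₁ r) y<w z~x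

  greedy⇒noncrossing : ∀ {P} → GreedyPartition (_≺ᶜ_ J) P → IsNoncrossing J P
  greedy⇒noncrossing {P} (sep , greedy) = record
    { nc1 = sep
    ; nc2 = nc2
    ; nc3 = λ i₁ i₂ j₁ j₂ bi bj i₁<j₁ j₁<j₂ j₂<i₂ i₁~j₁ →
        greedy j₂ bj bi j₂<i₂ (<-⊏-trans J i₁<j₁ (advancing (bumpMatching P sep) bj)) (inj₂ (i₁~j₁ , i₁<j₁))
    }
    where
    nc2 : ∀ i₁ i₂ j₁ j₂ → Bump P i₁ i₂ → Bump P j₁ j₂ → i₁ < j₁ → j₁ < i₂ → i₂ < j₂ →
          SameRegion J i₁ j₁ ⊎ SameRegion J i₂ j₁
    nc2 i₁ i₂ j₁ j₂ bi bj i₁<j₁ j₁<i₂ i₂<j₂ with _~?_ J i₁ j₁ | _~?_ J i₂ j₁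
    ... | yes p    | _        = inj₁ p
    ... | no  _    | yes q    = inj₂ q
    ... | no i₁≁j₁ | no i₂≁j₁ =
      -- Here `j₁` is available to `i₂` and lies in a later region than `i₁`, so it should have been
      -- taken.
      contradiction (inj₁ (i₁<j₁ , i₁≁j₁)) (greedy i₂ bi bj i₂<j₂ (j₁<i₂ , i₂≁j₁ ∘ ~-sym J))

-- The bijection preserving openers and closers

theorem5p3 : (n : ℕ) → n > 0 → (J : Subset (pred n)) → Bijection (NN n J) (NC n J)
theorem5p3 n _ J = record
  { to        = to
  ; cong      = λ {P} {Q} → to-cong P Q
  ; bijective = (λ {P} {Q} → to-injective P Q) , to-surjective
  }
  where
  module NN = Setoid (NN n J)
  module NC = Setoid (NC n J)

  ≺ᶜ-sto : IsStrictTotalOrder _≡_ (_≺ᶜ_ J)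
  ≺ᶜ-sto = ≺ᶜ-isStrictTotalOrder J

  image : ((P , _) : NN.Carrier) → ∃[ Q ] GreedyPartition J (_≺ᶜ_ J) Q × Bump P ≑ Bump Q
  image (P , nn) = greedyPartition-exists J ≺ᶜ-sto P (IsNonnesting.nn1 nn)

  to : NN.Carrier → NC.Carrier
  to P = proj₁ (image P) , greedy⇒noncrossing J (proj₁ (proj₂ (image P)))

  to-≑ : ∀ P → Bump (proj₁ P) ≑ Bump (proj₁ (to P))
  to-≑ P = proj₂ (proj₂ (image P))

  -- On either side the openers and closers determine the partition, so the remaining claims reduce
  -- to composing `≑`.
  NN-unique : ∀ P Q → Bump (proj₁ P) ≑ Bump (proj₁ Q) → P NN.≈ Q
  NN-unique (P , p) (Q , q) =
    greedyPartition-unique J <-isStrictTotalOrder P Q (nonnesting⇒greedy J p) (nonnesting⇒greedy J q)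

  NC-unique : ∀ P Q → Bump (proj₁ P) ≑ Bump (proj₁ Q) → P NC.≈ Q
  NC-unique (P , p) (Q , q) =
    greedyPartition-unique J ≺ᶜ-sto P Q (noncrossing⇒greedy J p) (noncrossing⇒greedy J q)

  to-cong : ∀ P Q → P NN.≈ Q → to P NC.≈ to Q
  to-cong P Q P≈Q = NC-unique (to P) (to Q)
    (≑-trans (≑-sym (to-≑ P)) (≑-trans (≈⇒≑ (proj₁ P) (proj₁ Q) P≈Q) (to-≑ Q)))

  to-injective : ∀ P Q → to P NC.≈ to Q → P NN.≈ Q
  to-injective P Q eq = NN-unique P Q
    (≑-trans (to-≑ P) (≑-trans (≈⇒≑ (proj₁ (to P)) (proj₁ (to Q)) eq) (≑-sym (to-≑ Q))))

  to-surjective : ∀ Q → ∃[ P ] (∀ {P′} → P′ NN.≈ P → to P′ NC.≈ Q)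
  -- The preimage comes from the same construction, run on `Q` with the order `<`.
  to-surjective Q with greedyPartition-exists J <-isStrictTotalOrder (proj₁ Q) (IsNoncrossing.nc1 (proj₂ Q))
  ... | P , greedy , Q≑P = (P , greedy⇒nonnesting J greedy) , λ {P′} P′≈P → NC-unique (to P′) Q
    (≑-trans (≑-sym (to-≑ P′)) (≑-trans (≈⇒≑ (proj₁ P′) P P′≈P) (≑-sym Q≑P)))
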